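{- The d-logic of all products of all $T_1$ spaces is $\langle\mathsf{K4},\mathsf{K4}\rangle$; that is, the set of all bimodal formulas $A$ such that $\mathfrak X_1\times\mathfrak X_2\models_d A$ for all $T_1$ topological spaces $\mathfrak X_1,\mathfrak X_2$ equals $\langle\mathsf{K4},\mathsf{K4}\rangle$.
   Context: A (normal modal) logic is a set of modal formulas (built from propositional letters, $\bot$, $\to$, $\Box_i$) containing all classical tautologies and $\Box_i(p\to q)\to(\Box_i p\to\Box_i q)$, closed under substitution, modus ponens and $A/\Box_i A$. $\mathsf{K}_n$ is the minimal one with $n$ modalities, $\mathsf K=\mathsf K_1$, and $\mathsf{L}+\Gamma$ is the minimal logic containing $\mathsf{L}\cup\Gamma$. $\mathsf{K4}=\mathsf K+\Box p\to\Box\Box p$. A formula is closed if it contains no propositional letters. Fusion: $\mathsf{L}_1*\mathsf{L}_2=\mathsf{K}_2+\mathsf{L}_1'+\mathsf{L}_2'$, where $\mathsf{L}_i'$ is $\mathsf{L}_i$ with every $\Box$ replaced by $\Box_i$. Let $\Delta=\{B\to\Box_2B : B \text{ closed and } \Box_2\text{ -free}\}\cup\{B\to\Box_1B: B\text{ closed and }\Box_1\text{ -free}\}$ and $\langle \mathsf{L}_1,\mathsf{L}_2\rangle=\mathsf{L}_1*\mathsf{L}_2+\Delta$. A neighborhood frame (n-frame) is $(X,\tau)$ with $X\neq\varnothing$ and each $\tau(x)$ a filter on $X$ (possibly containing $\varnothing$); an n-2-frame $(X,\tau_1,\tau_2)$ has two such functions. For a valuation, $x\models\Box_iA$ iff there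 is $U\in\tau_i(x)$ with $y\models A$ for all $y\in U$; Boolean connectives as usual; validity means truth at all points under all valuations. Product of n-frames: $(X_1,\tau_1)\times(X_2,\tau_2)=(X_1\times X_2,\tau_1^h,\tau_2^v)$, where $\tau_1^h(x_1,x_2)=\{U: \exists V\in\tau_1(x_1)\ V\times\{x_2\}\subseteq U\}$ and $\tau_2^v(x_1,x_2)=\{U:\exists V\in\tau_2(x_2)\ \{x_1\}\times V\subseteq U\}$. Derivational semantics: for a topological space $\mathfrak X=(X,T)$ ($X\ne\varnothing$), let $\tau_d^{\mathfrak X}(x)=\{U\subseteq X: \exists U'\in T\ (x\in U',\ U'\setminus\{x\}\subseteq U)\}$ and $\mathcal N_d(\mathfrak X)=(X,\tau_d^{\mathfrak X})$. For the product of topological spaces (the bitopological product with horizontal and vertical topologies, not the Tychonoff product), $\mathfrak X_1\times\mathfrak X_2\models_dA$ means that the bimodal formula $A$ is valid in the n-2-frame $\mathcal N_d(\mathfrak X_1)\times\mathcal N_d(\mathfrak X_2)$. -}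

module Defs where

open import Data.Bool.Base using (Bool; true; false; not; _∨_)
import Data.Empty as Empty
import Data.Empty.Polymorphic as Poly
open import Data.Fin.Base using (Fin; zero; suc)
open import Data.Nat.Base using (ℕ)
open import Data.Product.Base using (∃-syntax; _×_; _,_)
open import Data.Unit.Base using (⊤)
open import Level using (Level; Lift; 0ℓ) renaming (suc to lsuc)
open import Relation.Binary.PropositionalEquality.Core using (_≡_; _≢_)
open import Relation.Unary
  using (Pred; _∈_; _∉_; _⊆_; _≐_; ∅; ｛_｝; _∪_; _∩_; _∖_; ⋃; _⟨×⟩_)
open import Relation.Unary.Polymorphic using (U)

private
  variable
    n : ℕ
    ℓ : Level

------------------------------------------------------------------------
-- Formulas with n modalities

infixr 5 _⇒_

data Form (n : ℕ) : Set where
  var : ℕ → Form n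
  ⊥   : Form n
  _⇒_ : Form n → Form n → Form n
  □   : Fin n → Form n → Form n

subst : (ℕ → Form n) → Form n → Form n
subst σ (var p) = σ p
subst σ ⊥       = ⊥
subst σ (A ⇒ B) = subst σ A ⇒ subst σ B
subst σ (□ i A) = □ i (subst σ A)

relabel : Fin n → Form 1 → Form n
relabel i (var p) = var p
relabel i ⊥       = ⊥
relabel i (A ⇒ B) = relabel i A ⇒ relabel i B
relabel i (□ _ A) = □ i (relabel i A)

Closed : Pred (Form n) 0ℓ
Closed (var p) = Empty.⊥
Closed ⊥       = ⊤
Closed (A ⇒ B) = Closed A × Closed B
Closed (□ i A) = Closed A

□-Free : Fin n → Pred (Form n) 0ℓ
□-Free i (var p) = ⊤
□-Free i ⊥       = ⊤
□-Free i (A ⇒ B) = □-Free i A × □-Free i B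
□-Free i (□ j A) = i ≢ j × □-Free i A

-- Classical truth tables, with boxed formulas treated as atoms whose values
-- are given by b.

eval : (ℕ → Bool) → (Fin n → Form n → Bool) → Form n → Bool
eval v b (var p) = v p
eval v b ⊥       = false
eval v b (A ⇒ B) = not (eval v b A) ∨ eval v b B
eval v b (□ i A) = b i A

Tautology : Pred (Form n) 0ℓ
Tautology A = ∀ v b → eval v b A ≡ true

------------------------------------------------------------------------
-- Normal modal logics

record IsLogic (L : Pred (Form n) ℓ) : Set ℓ where
  field
    taut : ∀ {A} → Tautology A → A ∈ L
    dist : ∀ i → □ i (var 0 ⇒ var 1) ⇒ □ i (var 0) ⇒ □ i (var 1) ∈ L
    sub  : ∀ σ {A} → A ∈ L → subst σ A ∈ L
    mp   : ∀ {A B} → A ⇒ B ∈ L → A ∈ L → B ∈ L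
    nec  : ∀ i {A} → A ∈ L → □ i A ∈ L

-- The minimal logic containing Γ (see isLogic and minimal below).

data Logic (Γ : Pred (Form n) 0ℓ) : Pred (Form n) 0ℓ where
  ax   : ∀ {A} → A ∈ Γ → Logic Γ A
  taut : ∀ {A} → Tautology A → Logic Γ A
  dist : ∀ i → Logic Γ (□ i (var 0 ⇒ var 1) ⇒ □ i (var 0) ⇒ □ i (var 1))
  sub  : ∀ σ {A} → Logic Γ A → Logic Γ (subst σ A)
  mp   : ∀ {A B} → Logic Γ (A ⇒ B) → Logic Γ A → Logic Γ B
  nec  : ∀ i {A} → Logic Γ A → Logic Γ (□ i A)

isLogic : (Γ : Pred (Form n) 0ℓ) → IsLogic (Logic Γ)
isLogic Γ = record { taut = taut ; dist = dist ; sub = sub ; mp = mp ; nec = nec }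

minimal : {Γ : Pred (Form n) 0ℓ} {L : Pred (Form n) ℓ} →
          IsLogic L → Γ ⊆ L → Logic Γ ⊆ L
minimal {Γ = Γ} {L} isL Γ⊆L = go
  where
  module L = IsLogic isL
  go : Logic Γ ⊆ L
  go (ax A∈Γ)  = Γ⊆L A∈Γ
  go (taut t)  = L.taut t
  go (dist i)  = L.dist i
  go (sub σ d) = L.sub σ (go d)
  go (mp d e)  = L.mp (go d) (go e)
  go (nec i d) = L.nec i (go d)

infixl 6 _⊕_

_⊕_ : Pred (Form n) 0ℓ → Pred (Form n) 0ℓ → Pred (Form n) 0ℓ
L ⊕ Γ = Logic (L ∪ Γ)

K : (n : ℕ) → Pred (Form n) 0ℓ
K n = Logic ∅

K4 : Pred (Form 1) 0ℓ
K4 = K 1 ⊕ ｛ □ zero (var 0) ⇒ □ zero (□ zero (var 0)) ｝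

-- Indices of □₁ and □₂.

pattern #1 = zero
pattern #2 = suc zero

_[_] : Pred (Form 1) 0ℓ → Fin n → Pred (Form n) 0ℓ
(L [ i ]) A = ∃[ B ] B ∈ L × A ≡ relabel i B

infixl 7 _*_

_*_ : Pred (Form 1) 0ℓ → Pred (Form 1) 0ℓ → Pred (Form 2) 0ℓ
L₁ * L₂ = K 2 ⊕ L₁ [ #1 ] ⊕ L₂ [ #2 ]

-- The formulas B → □ᵢ B for B closed and □ᵢ-free.

Δ⟨_⟩ : Fin 2 → Pred (Form 2) 0ℓ
Δ⟨ i ⟩ A = ∃[ B ] Closed B × □-Free i B × A ≡ B ⇒ □ i B

Δ : Pred (Form 2) 0ℓ
Δ = Δ⟨ #2 ⟩ ∪ Δ⟨ #1 ⟩

⟨_,_⟩ : Pred (Form 1) 0ℓ → Pred (Form 1) 0ℓ → Pred (Form 2) 0ℓ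
⟨ L₁ , L₂ ⟩ = L₁ * L₂ ⊕ Δ

------------------------------------------------------------------------
-- Neighborhood frames
--
-- Subsets of X : Set ℓ are predicates Pred X ℓ.  Families of subsets, and
-- truth at a point, live one level up, since they may quantify over subsets.

record IsFilter {X : Set ℓ} (F : Pred (Pred X ℓ) (lsuc ℓ)) : Set (lsuc ℓ) where
  field
    whole : U ∈ F
    inter : ∀ {P Q} → P ∈ F → Q ∈ F → P ∩ Q ∈ F
    upper : ∀ {P Q} → P ⊆ Q → P ∈ F → Q ∈ F

-- n-frames are NFrame 1, n-2-frames are NFrame 2.

record NFrame (k : ℕ) (ℓ : Level) : Set (lsuc (lsuc ℓ)) where
  field
    Carrier  : Set ℓ
    nonempty : Carrier
    τ        : Fin k → Carrier → Pred (Pred Carrier ℓ) (lsuc ℓ)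
    isFilter : ∀ i x → IsFilter (τ i x)

Valuation : {k : ℕ} → NFrame k ℓ → Set (lsuc ℓ)
Valuation {ℓ} F = ℕ → Pred (NFrame.Carrier F) ℓ

module _ {k : ℕ} (F : NFrame k ℓ) where
  open NFrame F

  Truth : Valuation F → Carrier → Form k → Set (lsuc ℓ)
  Truth V x (var p) = Lift (lsuc ℓ) (x ∈ V p)
  Truth V x ⊥       = Poly.⊥
  Truth V x (A ⇒ B) = Truth V x A → Truth V x B
  Truth V x (□ i A) = ∃[ P ] P ∈ τ i x × (∀ y → y ∈ P → Truth V y A)

  Valid : Form k → Set (lsuc ℓ)
  Valid A = ∀ V x → Truth V x A

module _ (F₁ F₂ : NFrame 1 ℓ) where
  private
    module F₁ = NFrame F₁
    module F₂ = NFrame F₂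

  τ-× : Fin 2 → F₁.Carrier × F₂.Carrier →
        Pred (Pred (F₁.Carrier × F₂.Carrier) ℓ) (lsuc ℓ)
  τ-× #1 (x₁ , x₂) P = ∃[ V ] V ∈ F₁.τ zero x₁ × (V ⟨×⟩ ｛ x₂ ｝) ⊆ P
  τ-× #2 (x₁ , x₂) P = ∃[ V ] V ∈ F₂.τ zero x₂ × (｛ x₁ ｝ ⟨×⟩ V) ⊆ P

  τ-×-isFilter : ∀ i x → IsFilter (τ-× i x)
  τ-×-isFilter #1 (x₁ , x₂) = record
    { whole = U , whole , _
    ; inter = λ { (V , V∈τ , V⊆P) (W , W∈τ , W⊆Q) →
        V ∩ W , inter V∈τ W∈τ ,
        λ { ((v , w) , e) → V⊆P (v , e) , W⊆Q (w , e) } }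
    ; upper = λ { P⊆Q (V , V∈τ , V⊆P) → V , V∈τ , λ z → P⊆Q (V⊆P z) }
    }
    where open IsFilter (F₁.isFilter zero x₁)
  τ-×-isFilter #2 (x₁ , x₂) = record
    { whole = U , whole , _
    ; inter = λ { (V , V∈τ , V⊆P) (W , W∈τ , W⊆Q) →
        V ∩ W , inter V∈τ W∈τ ,
        λ { (e , (v , w)) → V⊆P (e , v) , W⊆Q (e , w) } }
    ; upper = λ { P⊆Q (V , V∈τ , V⊆P) → V , V∈τ , λ z → P⊆Q (V⊆P z) }
    }
    where open IsFilter (F₂.isFilter zero x₂)

infixr 7 _⊗_

_⊗_ : NFrame 1 ℓ → NFrame 1 ℓ → NFrame 2 ℓ
F₁ ⊗ F₂ = record
  { Carrier  = NFrame.Carrier F₁ × NFrame.Carrier F₂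
  ; nonempty = NFrame.nonempty F₁ , NFrame.nonempty F₂
  ; τ        = τ-× F₁ F₂
  ; isFilter = τ-×-isFilter F₁ F₂
  }

------------------------------------------------------------------------
-- Topological spaces and derivational semantics

-- Open-resp makes openness depend only on the extension of a subset.  The
-- empty set is open by Open-⋃ with an empty index type.  Classically every
-- family of subsets of X can be reindexed, up to ≐, by a type in Set ℓ, so
-- Open-⋃ covers arbitrary unions.

record Space (ℓ : Level) : Set (lsuc (lsuc ℓ)) where
  field
    Carrier   : Set ℓ
    nonempty  : Carrier
    Open      : Pred (Pred Carrier ℓ) (lsuc ℓ)
    Open-resp : ∀ {P Q} → P ≐ Q → Open P → Open Q
    Open-U    : Open U
    Open-∩    : ∀ {P Q} → Open P → Open Q → Open (P ∩ Q)
    Open-⋃    : (I : Set ℓ) (P : I → Pred Carrier ℓ) →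
                (∀ i → Open (P i)) → Open (⋃ I P)

T₁ : Space ℓ → Set (lsuc ℓ)
T₁ 𝔛 = ∀ x y → x ≢ y → ∃[ P ] Open P × x ∈ P × y ∉ P
  where open Space 𝔛

module _ (𝔛 : Space ℓ) where
  open Space 𝔛

  τᵈ : Carrier → Pred (Pred Carrier ℓ) (lsuc ℓ)
  τᵈ x P = ∃[ P′ ] Open P′ × x ∈ P′ × (P′ ∖ ｛ x ｝) ⊆ P

  τᵈ-isFilter : ∀ x → IsFilter (τᵈ x)
  τᵈ-isFilter x = record
    { whole = U , Open-U , _ , _
    ; inter = λ { (P′ , oP , x∈P , P⊆) (Q′ , oQ , x∈Q , Q⊆) →
        P′ ∩ Q′ , Open-∩ oP oQ , (x∈P , x∈Q) ,
        λ { ((p , q) , x≢y) → P⊆ (p , x≢y) , Q⊆ (q , x≢y) } }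
    ; upper = λ { P⊆Q (P′ , oP , x∈P , P⊆) → P′ , oP , x∈P , λ z → P⊆Q (P⊆ z) }
    }

  𝒩ᵈ : NFrame 1 ℓ
  𝒩ᵈ = record
    { Carrier  = Carrier
    ; nonempty = nonempty
    ; τ        = λ _ → τᵈ
    ; isFilter = λ _ → τᵈ-isFilter
    }

infix 4 _⊠_⊨ᵈ_

_⊠_⊨ᵈ_ : Space ℓ → Space ℓ → Form 2 → Set (lsuc ℓ)
𝔛₁ ⊠ 𝔛₂ ⊨ᵈ A = Valid (𝒩ᵈ 𝔛₁ ⊗ 𝒩ᵈ 𝔛₂) A

-- The d-logic of the class of products of a space in 𝒞₁ and a space in 𝒞₂.

d-Logic : Pred (Space ℓ) (lsuc ℓ) → Pred (Space ℓ) (lsuc ℓ) →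
          Pred (Form 2) (lsuc (lsuc ℓ))
d-Logic 𝒞₁ 𝒞₂ A = ∀ 𝔛₁ 𝔛₂ → 𝔛₁ ∈ 𝒞₁ → 𝔛₂ ∈ 𝒞₂ → 𝔛₁ ⊠ 𝔛₂ ⊨ᵈ A

{-# OPTIONS --safe #-}
module Submission where

-- Soundness: T₁ makes τᵈ transitive, and a closed □ᵢ-free formula does not see
-- the i-th coordinate.
--
-- Completeness: let w₀ be a world of the canonical model of ⟨ K4 , K4 ⟩.  Both
-- spaces consist of finite words of letters (n , v), n a time stamp and v a
-- world; the basic neighbourhoods of x are the sets of words obtained from x by
-- appending letters with time stamps ≥ k.  A pair of words is merged by time
-- stamps into a walk from w₀ through the canonical model, a letter of the i-th
-- word being a step along Rᵢ.  For fixed y, letters appended to x with large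
-- time stamps are read last, so the walk ends with Rᵢ-steps only, and reaches
-- every Rᵢ-successor.  Isolated points are the difficulty: which letters may be
-- appended to x must not depend on y.  By Δ the closed □₂-free theory of the
-- state reached from (x , y) depends on x only, namely on the last letter of x,
-- and every successor of that theory in the canonical frame of closed □₂-free
-- formulas lifts to an R₁-successor of the state.  So appending v is allowed
-- whenever the theory of v is such a successor.

open import Axiom.ExcludedMiddle using (ExcludedMiddle)
open import Data.Bool.Base using (Bool; true; false; not; _∨_; T; if_then_else_)
open import Data.Fin.Base using (Fin)
open import Data.List.Base using (List; []; _∷_; _++_; allFin; cartesianProductWith)
import Data.List.Membership.Propositional as List
open import Data.List.Membership.Propositional.Properties
  using (∈-++⁺ˡ; ∈-++⁺ʳ; ∈-cartesianProductWith⁺; ∈-allFin)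
open import Data.List.Relation.Unary.Any using (here; there)
open import Data.Nat.Base using (ℕ; _≤_; _⊔_; _≤ᵇ_; z≤n; s≤s)
open import Data.Nat.Properties
  using (≤-trans; m≤m⊔n; m≤n⊔m; n≮n; <⇒≤; ≤⇒≤ᵇ; ≤ᵇ⇒≤; m≤n⇒m<n∨m≡n)
open import Data.Product.Base using (∃-syntax; _×_; _,_; proj₁; proj₂)
open import Data.Sum.Base using (_⊎_; inj₁; inj₂) renaming ([_,_] to either)
open import Data.Unit.Base using (tt)
open import Function.Base using (_∘_; id)
open import Function.Bundles using (mk⇔)
open import Level using (Level; suc; 0ℓ; Lift; lift; lower)
open import Relation.Binary.PropositionalEquality
  using (_≡_; _≢_; refl; sym; trans; cong; cong₂) renaming (subst to ≡-subst)
open import Relation.Nullary.Decidable.Core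
  using (yes; no; does; proof; map′; toWitness; fromWitness; True; _→-dec_)
open import Relation.Nullary.Decidable using (dec-true; dec-false; does-⇔; decidable-stable)
open import Relation.Nullary.Negation using (¬_; contradiction)
open import Relation.Nullary.Reflects using (Reflects; ofⁿ; invert; _→-reflects_)
open import Relation.Unary using (Pred; _∈_; _⊆_; _≐_; ∅; _∪_; _∩_; ｛_｝; _⟨×⟩_)
open import Relation.Unary.Polymorphic using (U)
open import Defs

private
  variable
    n : ℕ
    ℓ : Level

four : Fin n → Form n
four i = □ i (var 0) ⇒ □ i (□ i (var 0))

-- Soundness

eval-relabel : ∀ v (b : Fin n → Form n → Bool) i A →
               eval v b (relabel i A) ≡ eval v (λ _ B → b i (relabel i B)) A
eval-relabel v b i (var p) = refl
eval-relabel v b i ⊥       = refl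
eval-relabel v b i (A ⇒ B) =
  cong₂ (λ a c → not a ∨ c) (eval-relabel v b i A) (eval-relabel v b i B)
eval-relabel v b i (□ _ A) = refl

relabel-subst : ∀ (i : Fin n) σ A →
                relabel i (subst σ A) ≡ subst (relabel i ∘ σ) (relabel i A)
relabel-subst i σ (var p) = refl
relabel-subst i σ ⊥       = refl
relabel-subst i σ (A ⇒ B) = cong₂ _⇒_ (relabel-subst i σ A) (relabel-subst i σ B)
relabel-subst i σ (□ _ A) = cong (□ i) (relabel-subst i σ A)

-- Truth tables treat boxed formulas as atoms, so relabelling keeps tautologies; it also commutes
-- with substitution. This brings the minimality of `K4` to the i-th modality of `L`.
relabel⁻¹-isLogic : {L : Pred (Form n) ℓ} → IsLogic L → ∀ i →
                    IsLogic (λ A → relabel i A ∈ L)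
relabel⁻¹-isLogic {L = L} isL i = record
  { taut = λ {A} t → L.taut λ v b → trans (eval-relabel v b i A) (t v _)
  ; dist = λ _ → L.dist i
  ; sub  = λ σ {A} A∈L → ≡-subst (_∈ L) (sym (relabel-subst i σ A)) (L.sub _ A∈L)
  ; mp   = L.mp
  ; nec  = λ _ → L.nec i
  }
  where module L = IsLogic isL

K4-relabel⊆ : {L : Pred (Form n) ℓ} → IsLogic L → ∀ i → four i ∈ L → K4 [ i ] ⊆ L
K4-relabel⊆ isL i four∈L (_ , B∈K4 , refl) =
  minimal isL′ (either (minimal isL′ (λ ())) λ { refl → four∈L }) B∈K4
  where isL′ = relabel⁻¹-isLogic isL i

⟨K4,K4⟩-minimal : {L : Pred (Form 2) ℓ} → IsLogic L → (∀ i → four i ∈ L) →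
                  Δ ⊆ L → ⟨ K4 , K4 ⟩ ⊆ L
⟨K4,K4⟩-minimal isL four∈L Δ⊆L =
  minimal isL (either
    (minimal isL (either
      (minimal isL (either
        (minimal isL (λ ()))
        (K4-relabel⊆ isL #1 (four∈L #1))))
      (K4-relabel⊆ isL #2 (four∈L #2))))
    Δ⊆L)

-- Validity in neighbourhood frames

module Validity {ℓ : Level} (em : ExcludedMiddle (suc ℓ)) {k : ℕ} (F : NFrame k ℓ) where
  open NFrame F

  truth-value : Valuation F → Carrier → Form k → Bool
  truth-value V x A = does (em {Truth F V x A})

  truth-eval : ∀ V x A →
    Reflects (Truth F V x A) (eval (truth-value V x ∘ var) (λ i → truth-value V x ∘ □ i) A)
  truth-eval V x (var p) = proof em
  truth-eval V x ⊥       = ofⁿ λ ()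
  truth-eval V x (A ⇒ B) = truth-eval V x A →-reflects truth-eval V x B
  truth-eval V x (□ i A) = proof em

  -- Truth is a type of level `suc ℓ`, while valuations take values of level `ℓ`; excluded middle
  -- resizes it through a Boolean.
  substV : (ℕ → Form k) → Valuation F → Valuation F
  substV σ V p x = Lift ℓ (True (em {Truth F V x (σ p)}))

  truth-subst⁺ : ∀ σ V x A → Truth F V x (subst σ A) → Truth F (substV σ V) x A
  truth-subst⁻ : ∀ σ V x A → Truth F (substV σ V) x A → Truth F V x (subst σ A)

  truth-subst⁺ σ V x (var p) t = lift (lift (fromWitness t))
  truth-subst⁺ σ V x (A ⇒ B) t = truth-subst⁺ σ V x B ∘ t ∘ truth-subst⁻ σ V x A
  truth-subst⁺ σ V x (□ i A) (P , P∈τ , t) =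
    P , P∈τ , λ y y∈P → truth-subst⁺ σ V y A (t y y∈P)

  truth-subst⁻ σ V x (var p) t = toWitness (lower (lower t))
  truth-subst⁻ σ V x (A ⇒ B) t = truth-subst⁻ σ V x B ∘ t ∘ truth-subst⁺ σ V x A
  truth-subst⁻ σ V x (□ i A) (P , P∈τ , t) =
    P , P∈τ , λ y y∈P → truth-subst⁻ σ V y A (t y y∈P)

  valid-isLogic : IsLogic (Valid F)
  valid-isLogic = record
    { taut = λ {A} t V x → invert (≡-subst (Reflects _) (t _ _) (truth-eval V x A))
    ; dist = λ { i V x (P , P∈τ , f) (Q , Q∈τ , g) →
        P ∩ Q , IsFilter.inter (isFilter i x) P∈τ Q∈τ ,
        λ { y (y∈P , y∈Q) → f y y∈P (g y y∈Q) } }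
    ; sub  = λ σ {A} t V x → truth-subst⁻ σ V x A (t (substV σ V) x)
    ; mp   = λ s t V x → s V x (t V x)
    ; nec  = λ i t V x → U , IsFilter.whole (isFilter i x) , λ y _ → t V y
    }

-- The neighbourhood condition for axiom 4. The set of all `y` with `P ∈ τ i y` lives one universe
-- too high to be a neighbourhood, so a smaller set `Q` stands in for it.
Transitive : {k : ℕ} → NFrame k ℓ → Set (suc ℓ)
Transitive F = ∀ i x P → P ∈ τ i x → ∃[ Q ] Q ∈ τ i x × (∀ y → y ∈ Q → P ∈ τ i y)
  where open NFrame F

four-valid : {k : ℕ} (F : NFrame k ℓ) → Transitive F → ∀ i → Valid F (four i)
four-valid F tr i V x (P , P∈τ , t) with tr i x P P∈τ
... | Q , Q∈τ , P∈τQ = Q , Q∈τ , λ y y∈Q → P , P∈τQ y y∈Q , t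

-- For `y` in `O` other than `x`, T₁ gives an open set around `y` that misses `x`; its intersection
-- with `O` lies in `P`.
𝒩ᵈ-transitive : (𝔛 : Space ℓ) → T₁ 𝔛 → Transitive (𝒩ᵈ 𝔛)
𝒩ᵈ-transitive 𝔛 t₁ _ x P (O , oO , x∈O , O∖x⊆P) =
  _ , (O , oO , x∈O , id) , λ { y (y∈O , x≢y) →
    let (N , oN , y∈N , x∉N) = t₁ y x (x≢y ∘ sym) in
    O ∩ N , Space.Open-∩ 𝔛 oO oN , (y∈O , y∈N) ,
    λ { {z} ((z∈O , z∈N) , _) → O∖x⊆P (z∈O , λ x≡z → x∉N (≡-subst N (sym x≡z) z∈N)) } }

⊗-transitive : (F₁ F₂ : NFrame 1 ℓ) → Transitive F₁ → Transitive F₂ → Transitive (F₁ ⊗ F₂)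
⊗-transitive F₁ F₂ tr₁ tr₂ #1 (x , y) P (V , V∈τ , V⊆P) with tr₁ #1 x V V∈τ
... | W , W∈τ , V∈τW =
  (W ⟨×⟩ ｛ y ｝) , (W , W∈τ , id) , λ { _ (z∈W , refl) → V , V∈τW _ z∈W , V⊆P }
⊗-transitive F₁ F₂ tr₁ tr₂ #2 (x , y) P (V , V∈τ , V⊆P) with tr₂ #1 y V V∈τ
... | W , W∈τ , V∈τW =
  (｛ x ｝ ⟨×⟩ W) , (W , W∈τ , id) , λ { _ (refl , z∈W) → V , V∈τW _ z∈W , V⊆P }

module _ (F₁ F₂ : NFrame 1 ℓ) where
  private
    module F₁ = NFrame F₁
    module F₂ = NFrame F₂

  -- Each column is a copy of the second frame, and a closed formula has no letters to tell columns
  -- apart, so neighbourhoods in one column can be moved to another.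
  □₁-free-invariant : ∀ V A → Closed A → □-Free #1 A → ∀ x x′ y →
                      Truth (F₁ ⊗ F₂) V (x , y) A → Truth (F₁ ⊗ F₂) V (x′ , y) A
  □₁-free-invariant V (A ⇒ B) (cA , cB) (fA , fB) x x′ y t =
    □₁-free-invariant V B cB fB x x′ y ∘ t ∘ □₁-free-invariant V A cA fA x′ x y
  □₁-free-invariant V (□ #1 A) cA (#1≢#1 , _) = contradiction refl #1≢#1
  □₁-free-invariant V (□ #2 A) cA (_ , fA) x x′ y (P , (W , W∈τ , W⊆P) , t) =
    (｛ x′ ｝ ⟨×⟩ W) , (W , W∈τ , id) ,
    λ { (_ , z) (refl , z∈W) →
        □₁-free-invariant V A cA fA x x′ z (t (x , z) (W⊆P (refl , z∈W))) }

  □₂-free-invariant : ∀ V A → Closed A → □-Free #2 A → ∀ x y y′ →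
                      Truth (F₁ ⊗ F₂) V (x , y) A → Truth (F₁ ⊗ F₂) V (x , y′) A
  □₂-free-invariant V (A ⇒ B) (cA , cB) (fA , fB) x y y′ t =
    □₂-free-invariant V B cB fB x y y′ ∘ t ∘ □₂-free-invariant V A cA fA x y′ y
  □₂-free-invariant V (□ #2 A) cA (#2≢#2 , _) = contradiction refl #2≢#2
  □₂-free-invariant V (□ #1 A) cA (_ , fA) x y y′ (P , (W , W∈τ , W⊆P) , t) =
    (W ⟨×⟩ ｛ y′ ｝) , (W , W∈τ , id) ,
    λ { (z , _) (z∈W , refl) →
        □₂-free-invariant V A cA fA z y y′ (t (z , y) (W⊆P (z∈W , refl))) }

  Δ-valid : Δ ⊆ Valid (F₁ ⊗ F₂)
  Δ-valid (inj₁ (B , cB , fB , refl)) V (x , y) t =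
    (｛ x ｝ ⟨×⟩ U) , (U , IsFilter.whole (F₂.isFilter #1 y) , id) ,
    λ { (_ , y′) (refl , _) → □₂-free-invariant V B cB fB x y y′ t }
  Δ-valid (inj₂ (B , cB , fB , refl)) V (x , y) t =
    (U ⟨×⟩ ｛ y ｝) , (U , IsFilter.whole (F₁.isFilter #1 x) , id) ,
    λ { (x′ , _) (_ , refl) → □₁-free-invariant V B cB fB x x′ y t }

soundness : ExcludedMiddle (suc ℓ) → ⟨ K4 , K4 ⟩ ⊆ d-Logic {ℓ} T₁ T₁
soundness em A∈L 𝔛₁ 𝔛₂ t₁ t₂ =
  ⟨K4,K4⟩-minimal (Validity.valid-isLogic em (𝒩ᵈ 𝔛₁ ⊗ 𝒩ᵈ 𝔛₂))
    (four-valid (𝒩ᵈ 𝔛₁ ⊗ 𝒩ᵈ 𝔛₂)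
      (⊗-transitive (𝒩ᵈ 𝔛₁) (𝒩ᵈ 𝔛₂) (𝒩ᵈ-transitive 𝔛₁ t₁) (𝒩ᵈ-transitive 𝔛₂ t₂)))
    (Δ-valid (𝒩ᵈ 𝔛₁) (𝒩ᵈ 𝔛₂)) A∈L

-- The canonical model

-- Finite cumulative lists exhausting the formulas, which serve as the enumeration in Lindenbaum's
-- construction.
forms : ℕ → List (Form n)
forms         ℕ.zero    = []
forms {n = n} (ℕ.suc k) = forms k ++ var k ∷ ⊥ ∷
  cartesianProductWith _⇒_ (forms k) (forms k) ++ cartesianProductWith □ (allFin n) (forms k)

forms-mono : ∀ {j k} {A : Form n} → j ≤ k → A List.∈ forms j → A List.∈ forms k
forms-mono {k = ℕ.zero}  z≤n A∈ = A∈
forms-mono {k = ℕ.suc k} j≤k A∈ with m≤n⇒m<n∨m≡n j≤k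
... | inj₁ (s≤s j≤k′) = ∈-++⁺ˡ (forms-mono j≤k′ A∈)
... | inj₂ refl = A∈

forms-complete : (A : Form n) → ∃[ k ] A List.∈ forms k
forms-complete (var p) = ℕ.suc p , ∈-++⁺ʳ (forms p) (here refl)
forms-complete ⊥       = 1 , there (here refl)
forms-complete (A ⇒ B) with forms-complete A | forms-complete B
... | j , A∈ | k , B∈ =
  ℕ.suc (j ⊔ k) , ∈-++⁺ʳ (forms (j ⊔ k)) (there (there (∈-++⁺ˡ
    (∈-cartesianProductWith⁺ _⇒_ (forms-mono (m≤m⊔n j k) A∈) (forms-mono (m≤n⊔m j k) B∈)))))
forms-complete (□ i A) with forms-complete A
... | k , A∈ =
  ℕ.suc k , ∈-++⁺ʳ (forms k) (there (there (∈-++⁺ʳ (cartesianProductWith _⇒_ (forms k) (forms k))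
    (∈-cartesianProductWith⁺ □ (∈-allFin i) A∈))))

module Canonical (em : ExcludedMiddle 0ℓ) {n : ℕ} {L : Pred (Form n) 0ℓ} (isL : IsLogic L) where
  module L = IsLogic isL

  infix 4 _⊢_

  -- Necessitation is not a rule here, which is what makes the deduction theorem hold.
  data _⊢_ (Γ : Pred (Form n) 0ℓ) : Form n → Set where
    hyp : ∀ {A} → A ∈ Γ → Γ ⊢ A
    thm : ∀ {A} → A ∈ L → Γ ⊢ A
    mp  : ∀ {A B} → Γ ⊢ A ⇒ B → Γ ⊢ A → Γ ⊢ B

  weaken : ∀ {Γ Γ′ A} → Γ ⊆ Γ′ → Γ ⊢ A → Γ′ ⊢ A
  weaken s (hyp A∈Γ) = hyp (s A∈Γ)
  weaken s (thm A∈L) = thm A∈L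
  weaken s (mp d e)  = mp (weaken s d) (weaken s e)

  ∅⊢ : ∀ {A} → ∅ ⊢ A → A ∈ L
  ∅⊢ (thm A∈L) = A∈L
  ∅⊢ (mp d e)  = L.mp (∅⊢ d) (∅⊢ e)

  ⇒-const : ∀ A B → A ⇒ B ⇒ A ∈ L
  ⇒-const A B = L.taut λ v b → go (eval v b A) (eval v b B)
    where
    go : ∀ a b → not a ∨ not b ∨ a ≡ true
    go false b     = refl
    go true  false = refl
    go true  true  = refl

  ⇒-distrib : ∀ A B C → (A ⇒ B ⇒ C) ⇒ (A ⇒ B) ⇒ A ⇒ C ∈ L
  ⇒-distrib A B C = L.taut λ v b → go (eval v b A) (eval v b B) (eval v b C)
    where
    go : ∀ a b c → not (not a ∨ not b ∨ c) ∨ not (not a ∨ b) ∨ not a ∨ c ≡ true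
    go false b     c     = refl
    go true  false c     = refl
    go true  true  false = refl
    go true  true  true  = refl

  ⇒-refl : ∀ A → A ⇒ A ∈ L
  ⇒-refl A = L.mp (L.mp (⇒-distrib A (A ⇒ A) A) (⇒-const A (A ⇒ A))) (⇒-const A A)

  ¬¬-elim : ∀ A → ((A ⇒ ⊥) ⇒ ⊥) ⇒ A ∈ L
  ¬¬-elim A = L.taut λ v b → go (eval v b A)
    where
    go : ∀ a → not (not (not a ∨ false) ∨ false) ∨ a ≡ true
    go false = refl
    go true  = refl

  ⊥-elim-thm : ∀ A → ⊥ ⇒ A ∈ L
  ⊥-elim-thm A = L.taut λ v b → refl

  infixr 6 _∧_

  _∧_ : Form n → Form n → Form n
  A ∧ B = (A ⇒ B ⇒ ⊥) ⇒ ⊥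

  ∧-mp : ∀ A A′ B C → (A ⇒ B ⇒ C) ⇒ (A′ ⇒ B) ⇒ A ∧ A′ ⇒ C ∈ L
  ∧-mp A A′ B C = L.taut λ v b → go (eval v b A) (eval v b A′) (eval v b B) (eval v b C)
    where
    go : ∀ a a′ b c → not (not a ∨ not b ∨ c) ∨ not (not a′ ∨ b) ∨
         not (not (not a ∨ not a′ ∨ false) ∨ false) ∨ c ≡ true
    go false false b     c     = refl
    go false true  false c     = refl
    go false true  true  c     = refl
    go true  false false c     = refl
    go true  false true  false = refl
    go true  false true  true  = refl
    go true  true  false c     = refl
    go true  true  true  false = refl
    go true  true  true  true  = refl

  deduction : ∀ {Γ A B} → Γ ∪ ｛ A ｝ ⊢ B → Γ ⊢ A ⇒ B
  deduction (hyp (inj₁ B∈Γ))  = mp (thm (⇒-const _ _)) (hyp B∈Γ)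
  deduction (hyp (inj₂ refl)) = thm (⇒-refl _)
  deduction (thm B∈L)         = mp (thm (⇒-const _ _)) (thm B∈L)
  deduction (mp d e)          = mp (mp (thm (⇒-distrib _ _ _)) (deduction d)) (deduction e)

  Consistent : Pred (Form n) 0ℓ → Set
  Consistent Γ = ¬ (Γ ⊢ ⊥)

  -- Maximal consistent sets as Boolean functions: this keeps `World` in `Set`, so that worlds can
  -- be letters of words at every level.
  record World : Set where
    field
      mem     : Form n → Bool
      mem-⊥   : mem ⊥ ≡ false
      mem-⇒   : ∀ A B → mem (A ⇒ B) ≡ not (mem A) ∨ mem B
      mem-thm : ∀ {A} → A ∈ L → mem A ≡ true

  open World public

  infix 4 _∋_

  _∋_ : World → Form n → Set
  w ∋ A = mem w A ≡ true

  ∋-mp : ∀ w {A B} → w ∋ A ⇒ B → w ∋ A → w ∋ B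
  ∋-mp w {A} {B} A⇒B∈w A∈w =
    trans (cong (λ a → not a ∨ mem w B) (sym A∈w)) (trans (sym (mem-⇒ w A B)) A⇒B∈w)

  ∋-⊥ : ∀ w → ¬ (w ∋ ⊥)
  ∋-⊥ w ⊥∈w with () ← trans (sym (mem-⊥ w)) ⊥∈w

  ∋-¬ : ∀ w {A} → mem w A ≡ false → w ∋ A ⇒ ⊥
  ∋-¬ w {A} A∉w = trans (mem-⇒ w A ⊥) (cong (λ a → not a ∨ mem w ⊥) A∉w)

  ∋-¬⁻ : ∀ w {A} → w ∋ A ⇒ ⊥ → mem w A ≡ false
  ∋-¬⁻ w {A} ¬A∈w with mem w A in A∈w
  ... | false = refl
  ... | true  = contradiction (∋-mp w ¬A∈w A∈w) (∋-⊥ w)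

  ∋-¬∋ : ∀ w {A} → ¬ (w ∋ A) → w ∋ A ⇒ ⊥
  ∋-¬∋ w {A} A∉w with mem w A in eq
  ... | true  = contradiction refl A∉w
  ... | false = ∋-¬ w eq

  -- Lindenbaum's construction

  module _ {Γ₀ : Pred (Form n) 0ℓ} (con₀ : Consistent Γ₀) where

    -- The consistency test is a conjunct of the predicate, so an inconsistent `A` adds nothing and
    -- the definition needs no case distinction.
    add : Pred (Form n) 0ℓ → Form n → Pred (Form n) 0ℓ
    add Γ A B = B ∈ Γ ⊎ (A ≡ B × Consistent (Γ ∪ ｛ A ｝))

    addAll : Pred (Form n) 0ℓ → List (Form n) → Pred (Form n) 0ℓ
    addAll Γ []       = Γ
    addAll Γ (A ∷ As) = addAll (add Γ A) As

    stage : ℕ → Pred (Form n) 0ℓ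
    stage ℕ.zero    = Γ₀
    stage (ℕ.suc k) = addAll (stage k) (forms k)

    limit : Pred (Form n) 0ℓ
    limit A = ∃[ k ] A ∈ stage k

    add-consistent : ∀ {Γ} A → Consistent Γ → Consistent (add Γ A)
    add-consistent {Γ} A con d with em {Consistent (Γ ∪ ｛ A ｝)}
    ... | yes con′ = con′ (weaken (λ { (inj₁ B∈Γ) → inj₁ B∈Γ ; (inj₂ (e , _)) → inj₂ e }) d)
    ... | no ¬con′ =
      con (weaken (λ { (inj₁ B∈Γ) → B∈Γ ; (inj₂ (_ , c)) → contradiction c ¬con′ }) d)

    addAll-consistent : ∀ {Γ} As → Consistent Γ → Consistent (addAll Γ As)
    addAll-consistent []       con = con
    addAll-consistent (A ∷ As) con = addAll-consistent As (add-consistent A con)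

    stage-consistent : ∀ k → Consistent (stage k)
    stage-consistent ℕ.zero    = con₀
    stage-consistent (ℕ.suc k) = addAll-consistent (forms k) (stage-consistent k)

    ⊆-addAll : ∀ {Γ} As → Γ ⊆ addAll Γ As
    ⊆-addAll []       B∈Γ = B∈Γ
    ⊆-addAll (A ∷ As) B∈Γ = ⊆-addAll As (inj₁ B∈Γ)

    stage-mono : ∀ {j k} → j ≤ k → stage j ⊆ stage k
    stage-mono {k = ℕ.zero}  z≤n B∈ = B∈
    stage-mono {k = ℕ.suc k} j≤k B∈ with m≤n⇒m<n∨m≡n j≤k
    ... | inj₁ (s≤s j≤k′) = ⊆-addAll (forms k) (stage-mono j≤k′ B∈)
    ... | inj₂ refl = B∈

    compactness : ∀ {A} → limit ⊢ A → ∃[ k ] stage k ⊢ A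
    compactness (hyp (k , A∈)) = k , hyp A∈
    compactness (thm A∈L)      = 0 , thm A∈L
    compactness (mp d e) with compactness d | compactness e
    ... | j , d′ | k , e′ =
      j ⊔ k , mp (weaken (stage-mono (m≤m⊔n j k)) d′) (weaken (stage-mono (m≤n⊔m j k)) e′)

    limit-consistent : Consistent limit
    limit-consistent d with compactness d
    ... | k , d′ = stage-consistent k d′

    -- When the list reaches `A`, the set built so far either takes it in or refutes it by the
    -- deduction theorem; later additions preserve both.
    addAll-decides : ∀ {Γ A} As → A List.∈ As → addAll Γ As ⊢ A ⊎ addAll Γ As ⊢ A ⇒ ⊥
    addAll-decides (_ ∷ As) (there A∈As) = addAll-decides As A∈As
    addAll-decides {Γ} (A ∷ As) (here refl) with em {Γ ∪ ｛ A ｝ ⊢ ⊥}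
    ... | no con = inj₁ (hyp (⊆-addAll As (inj₂ (refl , con))))
    ... | yes d  = inj₂ (weaken (⊆-addAll As ∘ inj₁) (deduction d))

    limit-decides : ∀ A → limit ⊢ A ⊎ limit ⊢ A ⇒ ⊥
    limit-decides A with forms-complete A
    ... | k , A∈ with addAll-decides {stage k} (forms k) A∈
    ...   | inj₁ d = inj₁ (weaken (ℕ.suc k ,_) d)
    ...   | inj₂ d = inj₂ (weaken (ℕ.suc k ,_) d)

    limit-⇒ : ∀ {A B} → (limit ⊢ A → limit ⊢ B) → limit ⊢ A ⇒ B
    limit-⇒ {A} {B} f with limit-decides A
    ... | inj₁ d = mp (thm (⇒-const B A)) (f d)
    ... | inj₂ d = mp (mp (thm (⇒-distrib A ⊥ B))
                          (mp (thm (⇒-const _ A)) (thm (⊥-elim-thm B)))) d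

    lindenbaum : ∃[ w ] (∀ {A} → A ∈ Γ₀ → w ∋ A)
    lindenbaum = record
      { mem     = λ A → does (em {limit ⊢ A})
      ; mem-⊥   = dec-false em limit-consistent
      ; mem-⇒   = λ A B → does-⇔ (mk⇔ mp limit-⇒) em (em →-dec em)
      ; mem-thm = λ A∈L → dec-true em (thm A∈L)
      } , λ A∈Γ₀ → dec-true em (hyp (0 , A∈Γ₀))

  □⁻ : Fin n → World → Pred (Form n) 0ℓ
  □⁻ i w A = w ∋ □ i A

  record R (i : Fin n) (w v : World) : Set where
    constructor mkR
    field ∋□⇒∋ : ∀ {A} → w ∋ □ i A → v ∋ A

  open R public

  -- A box passes through a derivation: necessitation covers theorems, and the distribution axiom
  -- covers modus ponens.
  □-intro : ∀ i w {A} → □⁻ i w ⊢ A → w ∋ □ i A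
  □-intro i w (hyp □A∈w) = □A∈w
  □-intro i w (thm A∈L)  = mem-thm w (L.nec i A∈L)
  □-intro i w (mp {A} {B} d e) =
    ∋-mp w (∋-mp w (mem-thm w (L.sub σ (L.dist i))) (□-intro i w d)) (□-intro i w e)
    where
    σ : ℕ → Form n
    σ ℕ.zero    = A
    σ (ℕ.suc _) = B

  -- If `□⁻ i w` were inconsistent with the negation of `A`, it would derive `A`, and `□-intro`
  -- would put `□ i A` into `w`.
  □-witness : ∀ i w {A} → ¬ (w ∋ □ i A) → ∃[ v ] R i w v × ¬ (v ∋ A)
  □-witness i w {A} □A∉w
    with lindenbaum {□⁻ i w ∪ ｛ A ⇒ ⊥ ｝}
           (λ d → □A∉w (□-intro i w (mp (thm (¬¬-elim A)) (deduction d))))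
  ... | v , Γ⊆v = v , mkR (Γ⊆v ∘ inj₁) ,
                  λ A∈v → ∋-⊥ v (∋-mp v (Γ⊆v (inj₂ refl)) A∈v)

  -- A derivation uses finitely many members of `C`, and their conjunction is again in `C`; `⊥ ⇒ ⊥`
  -- serves where none is used.
  ∧-deduction : ∀ {Γ} {C : Pred (Form n) 0ℓ} → ⊥ ⇒ ⊥ ∈ C → (∀ {A B} → A ∈ C → B ∈ C → A ∧ B ∈ C) →
                ∀ {A} → Γ ∪ C ⊢ A → ∃[ B ] B ∈ C × Γ ⊢ B ⇒ A
  ∧-deduction ⊤∈C ∧∈C (hyp (inj₁ A∈Γ)) = _ , ⊤∈C , mp (thm (⇒-const _ _)) (hyp A∈Γ)
  ∧-deduction ⊤∈C ∧∈C (hyp (inj₂ A∈C)) = _ , A∈C , thm (⇒-refl _)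
  ∧-deduction ⊤∈C ∧∈C (thm A∈L)        = _ , ⊤∈C , mp (thm (⇒-const _ _)) (thm A∈L)
  ∧-deduction ⊤∈C ∧∈C (mp d e)
    with ∧-deduction ⊤∈C ∧∈C d | ∧-deduction ⊤∈C ∧∈C e
  ... | B , B∈C , d′ | B′ , B′∈C , e′ =
    B ∧ B′ , ∧∈C B∈C B′∈C , mp (mp (thm (∧-mp _ _ _ _)) d′) e′

  ∋-∧ : ∀ w {A B} → w ∋ A → w ∋ B → w ∋ A ∧ B
  ∋-∧ w A∈w B∈w = ∋-¬∋ w λ A⇒¬B∈w → ∋-⊥ w (∋-mp w (∋-mp w A⇒¬B∈w A∈w) B∈w)

-- The countermodel

if-intro : ∀ {a p} {A : Set a} (P : Pred A p) b {x y} → x ∈ P → y ∈ P → (if b then x else y) ∈ P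
if-intro P true  x∈P y∈P = x∈P
if-intro P false x∈P y∈P = y∈P

other : Fin 2 → Fin 2
other #1 = #2
other #2 = #1

other-≢ : ∀ i → other i ≢ i
other-≢ #1 ()
other-≢ #2 ()

-- The formulas about the i-th coordinate only.

record ClosedAt (i : Fin 2) (A : Form 2) : Set where
  constructor closedAt
  field
    isClosed : Closed A
    isFree   : □-Free (other i) A

closedAt-⊥ : ∀ {i} → ClosedAt i ⊥
closedAt-⊥ = closedAt tt tt

closedAt-⇒ : ∀ {i A B} → ClosedAt i A → ClosedAt i B → ClosedAt i (A ⇒ B)
closedAt-⇒ (closedAt cA fA) (closedAt cB fB) = closedAt (cA , cB) (fA , fB)

closedAt-□ : ∀ {i A} → ClosedAt i A → ClosedAt i (□ i A)
closedAt-□ {i} (closedAt cA fA) = closedAt cA (other-≢ i , fA)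

module Countermodel (ℓ : Level) (em : ExcludedMiddle 0ℓ) where
  open Canonical em (isLogic (K4 * K4 ∪ Δ)) public

  four∈ : ∀ i → four i ∈ ⟨ K4 , K4 ⟩
  four∈ #1 = ax (inj₁ (ax (inj₁ (ax (inj₂ (_ , ax (inj₂ refl) , refl))))))
  four∈ #2 = ax (inj₁ (ax (inj₂ (_ , ax (inj₂ refl) , refl))))

  Δ∈ : ∀ i {A} → ClosedAt (other i) A → A ⇒ □ i A ∈ ⟨ K4 , K4 ⟩
  Δ∈ #1 (closedAt cA fA) = ax (inj₂ (inj₂ (_ , cA , fA , refl)))
  Δ∈ #2 (closedAt cA fA) = ax (inj₂ (inj₁ (_ , cA , fA , refl)))

  R-trans : ∀ {i u v w} → R i u v → R i v w → R i u w
  R-trans {i} {u} uRv vRw = mkR λ {A} □A∈u →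
    ∋□⇒∋ vRw (∋□⇒∋ uRv (∋-mp u (mem-thm u (sub (λ _ → A) (four∈ i))) □A∈u))

  -- Equality of points in the canonical frame of the closed formulas about coordinate `i`, with
  -- worlds as representatives.
  record Agree (i : Fin 2) (w v : World) : Set where
    constructor mkAgree
    field agree : ∀ {A} → ClosedAt i A → mem w A ≡ mem v A

  open Agree

  agree-refl : ∀ {i w} → Agree i w w
  agree-refl = mkAgree λ _ → refl

  agree-sym : ∀ {i w v} → Agree i w v → Agree i v w
  agree-sym w≈v = mkAgree λ cA → sym (agree w≈v cA)

  agree-trans : ∀ {i u v w} → Agree i u v → Agree i v w → Agree i u w
  agree-trans u≈v v≈w = mkAgree λ cA → trans (agree u≈v cA) (agree v≈w cA)

  -- The formulas in `ClosedAt i` are closed under negation, so one inclusion between the two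
  -- theories forces equality.
  ⊆⇒agree : ∀ {i} w v → (∀ {A} → ClosedAt i A → w ∋ A → v ∋ A) → Agree i w v
  ⊆⇒agree {i} w v w⊆v = mkAgree go
    where
    go : ∀ {A} → ClosedAt i A → mem w A ≡ mem v A
    go {A} cA with mem w A in eq
    ... | true  = sym (w⊆v cA eq)
    ... | false = sym (∋-¬⁻ v (w⊆v (closedAt-⇒ cA closedAt-⊥) (∋-¬ w eq)))

  -- The axioms Δ carry every closed formula about the other coordinate along `R i`.
  R⇒agree-other : ∀ {i w v} → R i w v → Agree (other i) w v
  R⇒agree-other {i} {w} {v} wRv =
    ⊆⇒agree w v λ cA A∈w → ∋□⇒∋ wRv (∋-mp w (mem-thm w (Δ∈ i cA)) A∈w)

  -- The accessibility relation of the canonical frame of the closed fragment.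
  record Rᶜ (i : Fin 2) (w v : World) : Set where
    constructor mkRᶜ
    field ∋□⇒∋ᶜ : ∀ {A} → ClosedAt i A → w ∋ □ i A → v ∋ A

  open Rᶜ

  R⇒Rᶜ : ∀ {i w v} → R i w v → Rᶜ i w v
  R⇒Rᶜ wRv = mkRᶜ λ _ → ∋□⇒∋ wRv

  Rᶜ-agree : ∀ {i u w v} → Agree i w u → Rᶜ i u v → Rᶜ i w v
  Rᶜ-agree w≈u uRv = mkRᶜ λ cA □A∈w →
    ∋□⇒∋ᶜ uRv cA (trans (sym (agree w≈u (closedAt-□ cA))) □A∈w)

  -- Otherwise `□⁻ i w` refutes a conjunction `B` of closed formulas of `v`. Then the boxed negation
  -- of `B` is in `w`, and since that negation is itself closed, `Rᶜ` puts it into `v` beside `B`.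
  Rᶜ-lift : ∀ i w v → Rᶜ i w v → ∃[ v′ ] R i w v′ × Agree i v′ v
  Rᶜ-lift i w v wRv =
    let (v′ , Γ⊆v′) = lindenbaum consistent in
    v′ , mkR (Γ⊆v′ ∘ inj₁) , agree-sym (⊆⇒agree v v′ λ cA A∈v → Γ⊆v′ (inj₂ (cA , A∈v)))
    where
    consistent : Consistent (□⁻ i w ∪ (ClosedAt i ∩ (v ∋_)))
    consistent d with ∧-deduction (closedAt-⇒ closedAt-⊥ closedAt-⊥ , mem-thm v (⇒-refl ⊥))
      (λ { (cA , A∈v) (cB , B∈v) →
           closedAt-⇒ (closedAt-⇒ cA (closedAt-⇒ cB closedAt-⊥)) closedAt-⊥ , ∋-∧ v A∈v B∈v }) d
    ... | B , (cB , B∈v) , d′ =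
      ∋-⊥ v (∋-mp v (∋□⇒∋ᶜ wRv (closedAt-⇒ cB closedAt-⊥) (□-intro i w d′)) B∈v)

  -- The walk's move on reading the letter `v` at `w`. A true `R`-successor is kept unchanged, so
  -- that every `R`-successor can be reached; any other `Rᶜ`-successor is replaced by its lift.
  step : ∀ i w v → ∃[ v′ ] (Rᶜ i w v → R i w v′ × Agree i v′ v × (R i w v → v′ ≡ v))
  step i w v with em {R i w v} | em {Rᶜ i w v}
  ... | yes wRv | _        = v , λ _ → wRv , agree-refl , λ _ → refl
  -- A default value that makes `state` total; legal words never lead here.
  ... | no _    | no ¬wRᶜv = w , λ wRᶜv → contradiction wRᶜv ¬wRᶜv
  ... | no ¬wRv | yes wRᶜv with Rᶜ-lift i w v wRᶜv
  ...   | v′ , wRv′ , v′≈v = v′ , λ _ → wRv′ , v′≈v , λ wRv → contradiction wRv ¬wRv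

  -- The spaces of words

  infixl 5 _▷[_,_]

  data Word : Set ℓ where
    ε       : Word
    _▷[_,_] : Word → ℕ → World → Word

  -- Not the length: the least time stamp later than that of the last letter. Stamps inside a word
  -- need not increase.
  height : Word → ℕ
  height ε              = 0
  height (x ▷[ k , v ]) = ℕ.suc k

  module _ (w₀ : World) where

    last : Word → World
    last ε              = w₀
    last (x ▷[ k , v ]) = v

    module _ (i : Fin 2) where

      -- Illegal words are points too, but extensions in a cone of a legal word are legal, and the
      -- truth lemma concerns legal words only.
      data Legal : Word → Set ℓ where
        ε   : Legal ε
        _▷_ : ∀ {x k v} → Legal x → Rᶜ i (last x) v → Legal (x ▷[ k , v ])

      infix 4 _≺[_]_

      data _≺[_]_ (x : Word) (k : ℕ) : Word → Set ℓ where
        one  : ∀ {m v} → k ≤ m → Rᶜ i (last x) v → x ≺[ k ] x ▷[ m , v ]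
        more : ∀ {y m v} → x ≺[ k ] y → k ≤ m → Rᶜ i (last y) v → x ≺[ k ] y ▷[ m , v ]

      ≺-anti : ∀ {x y j k} → j ≤ k → x ≺[ k ] y → x ≺[ j ] y
      ≺-anti j≤k (one k≤m r)      = one (≤-trans j≤k k≤m) r
      ≺-anti j≤k (more x≺y k≤m r) = more (≺-anti j≤k x≺y) (≤-trans j≤k k≤m) r

      ≺-trans : ∀ {x y z k} → x ≺[ k ] y → y ≺[ k ] z → x ≺[ k ] z
      ≺-trans x≺y (one k≤m r)      = more x≺y k≤m r
      ≺-trans x≺y (more y≺z k≤m r) = more (≺-trans x≺y y≺z) k≤m r

      -- The last letter of `y` is stamped strictly below `height y`. This separates points for T₁
      -- and keeps a centre out of its own cone.
      ≺-height : ∀ {x} y → ¬ (x ≺[ height y ] y)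
      ≺-height (y ▷[ m , v ]) (one m<m _)    = n≮n m m<m
      ≺-height (y ▷[ m , v ]) (more _ m<m _) = n≮n m m<m

      ≺-legal : ∀ {x y k} → Legal x → x ≺[ k ] y → Legal y
      ≺-legal lx (one _ r)      = lx ▷ r
      ≺-legal lx (more x≺y _ r) = ≺-legal lx x≺y ▷ r

      record IsOpen (P : Pred Word ℓ) : Set (suc ℓ) where
        constructor isOpen
        field nbhd : ∀ {x} → x ∈ P → ∃[ k ] (∀ {y} → x ≺[ k ] y → y ∈ P)

      open IsOpen

      words : Space ℓ
      words = record
        { Carrier   = Word
        ; nonempty  = ε
        ; Open      = IsOpen
        ; Open-resp = λ { (P⊆Q , Q⊆P) oP → isOpen λ x∈Q →
            let (k , s) = nbhd oP (Q⊆P x∈Q) in k , P⊆Q ∘ s }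
        ; Open-U    = isOpen λ _ → 0 , _
        ; Open-∩    = λ { oP oQ → isOpen λ { (x∈P , x∈Q) →
            let (j , s) = nbhd oP x∈P
                (k , t) = nbhd oQ x∈Q
            in j ⊔ k , λ x≺y → s (≺-anti (m≤m⊔n j k) x≺y) , t (≺-anti (m≤n⊔m j k) x≺y) } }
        ; Open-⋃    = λ I P oP → isOpen λ { (j , x∈P) →
            let (k , s) = nbhd (oP j) x∈P in k , λ x≺y → j , s x≺y }
        }

      cone-open : ∀ x k → IsOpen (｛ x ｝ ∪ (x ≺[ k ]_))
      cone-open x k = isOpen λ
        { (inj₁ refl) → k , inj₂
        ; (inj₂ x≺y)  → k , λ y≺z → inj₂ (≺-trans x≺y y≺z) }

      words-T₁ : T₁ words
      words-T₁ x y x≢y =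
        _ , cone-open x (height y) , inj₁ refl , either x≢y (≺-height y)

      τᵈ-cone : ∀ x k → (x ≺[ k ]_) ∈ τᵈ words x
      τᵈ-cone x k = _ , cone-open x k , inj₁ refl ,
        λ { (inj₁ x≡y , x≢y) → contradiction x≡y x≢y ; (inj₂ x≺y , _) → x≺y }

      τᵈ⇒cone : ∀ {x P} → P ∈ τᵈ words x → ∃[ k ] (∀ {y} → x ≺[ k ] y → y ∈ P)
      τᵈ⇒cone {x} (O , oO , x∈O , O∖x⊆P) with nbhd oO x∈O
      -- The bound `height x` excludes `x` itself, as `O` is known to lie in `P` only away from `x`.
      ... | k , s = k ⊔ height x , λ x≺y → O∖x⊆P
        ( s (≺-anti (m≤m⊔n k _) x≺y)
        , λ { refl → ≺-height x (≺-anti (m≤n⊔m k _) x≺y) } )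

      -- h is the state as a function of the i-th word, the other word being fixed.

      module Line (h : Word → World) (N : ℕ) (h-▷ : ∀ x {m} v → N ≤ m → h (x ▷[ m , v ]) ≡ proj₁ (step i (h x) v)) (h-agree : ∀ {x} → Legal x → Agree i (h x) (last x)) where

        h-Rᶜ : ∀ {x v} → Legal x → Rᶜ i (last x) v → Rᶜ i (h x) v
        h-Rᶜ lx = Rᶜ-agree (h-agree lx)

        h-step : ∀ {x m v} → Legal x → N ≤ m → Rᶜ i (last x) v → R i (h x) (h (x ▷[ m , v ]))
        h-step {x} {m} {v} lx N≤m r =
          ≡-subst (R i (h x)) (sym (h-▷ x v N≤m)) (proj₁ (proj₂ (step i (h x) v) (h-Rᶜ lx r)))

        -- Letters stamped `N` or later are read after the whole fixed word, so each is an `R i`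
        -- step; transitivity composes them.
        h-forth : ∀ {x y} → Legal x → x ≺[ N ] y → R i (h x) (h y)
        h-forth lx (one N≤m r)      = h-step lx N≤m r
        h-forth lx (more x≺y N≤m r) = R-trans (h-forth lx x≺y) (h-step (≺-legal lx x≺y) N≤m r)

        h-back : ∀ {x v} → Legal x → R i (h x) v → ∀ k → ∃[ y ] x ≺[ k ] y × h y ≡ v
        h-back {x} {v} lx hxRv k =
          -- The letter is the target world itself, which `step` keeps. The stamp is at least `k` to
          -- lie in the cone and at least `N` to be read last.
          x ▷[ k ⊔ N , v ] , one (m≤m⊔n k N) r ,
          trans (h-▷ x v (m≤n⊔m k N)) (proj₂ (proj₂ (proj₂ (step i (h x) v) (h-Rᶜ lx r))) hxRv)
          where
          r : Rᶜ i (last x) v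
          r = Rᶜ-agree (agree-sym (h-agree lx)) (R⇒Rᶜ hxRv)

    -- Merging two words into a walk

    state : Word → Word → World
    state ε                ε                = w₀
    state (x ▷[ _ , v ])   ε                = proj₁ (step #1 (state x ε) v)
    state ε                (y ▷[ _ , u ])   = proj₁ (step #2 (state ε y) u)
    -- The later of the two final letters is read last; on a tie it is that of the second word.
    state (x ▷[ k , v ])   (y ▷[ m , u ])   = if k ≤ᵇ m
      then proj₁ (step #2 (state (x ▷[ k , v ]) y) u)
      else proj₁ (step #1 (state x (y ▷[ m , u ])) v)

    -- The bound makes `k` strictly larger than the last stamp of `y`, so no tie can favour the
    -- second word.
    state-▷₁ : ∀ y x {k} v → height y ≤ k → state (x ▷[ k , v ]) y ≡ proj₁ (step #1 (state x y) v)
    state-▷₁ ε              x     v _   = refl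
    state-▷₁ (y ▷[ m , u ]) x {k} v m<k with k ≤ᵇ m in eq
    ... | false = refl
    ... | true  = contradiction (≤-trans m<k (≤ᵇ⇒≤ k m (≡-subst T (sym eq) tt))) (n≮n m)

    state-▷₂ : ∀ x y {m} u → height x ≤ m → state x (y ▷[ m , u ]) ≡ proj₁ (step #2 (state x y) u)
    state-▷₂ ε              y     u _   = refl
    state-▷₂ (x ▷[ k , v ]) y {m} u k<m with k ≤ᵇ m | ≤⇒≤ᵇ (<⇒≤ k<m)
    ... | true | _ = refl

    AgreeLast : World → Word → Word → Set
    AgreeLast w x y = Agree #1 w (last x) × Agree #2 w (last y)

    -- In the first coordinate the new state agrees with the letter just read, by lifting; in the
    -- second nothing changes, by Δ.
    step-agree₁ : ∀ w x y k {v} → Rᶜ #1 (last x) v → AgreeLast w x y →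
                  AgreeLast (proj₁ (step #1 w v)) (x ▷[ k , v ]) y
    step-agree₁ w x y k {v} r (w≈x , w≈y) with proj₂ (step #1 w v) (Rᶜ-agree w≈x r)
    ... | wRv′ , v′≈v , _ = v′≈v , agree-trans (agree-sym (R⇒agree-other wRv′)) w≈y

    step-agree₂ : ∀ w x y m {u} → Rᶜ #2 (last y) u → AgreeLast w x y →
                  AgreeLast (proj₁ (step #2 w u)) x (y ▷[ m , u ])
    step-agree₂ w x y m {u} r (w≈x , w≈y) with proj₂ (step #2 w u) (Rᶜ-agree w≈y r)
    ... | wRu′ , u′≈u , _ = agree-trans (agree-sym (R⇒agree-other wRu′)) w≈x , u′≈u

    state-agree : ∀ {x y} → Legal #1 x → Legal #2 y → AgreeLast (state x y) x y
    state-agree ε ε = agree-refl , agree-refl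
    state-agree {x ▷[ k , _ ]} (lx ▷ r) ε = step-agree₁ (state x ε) x ε k r (state-agree lx ε)
    state-agree {y = y ▷[ m , _ ]} ε (ly ▷ s) = step-agree₂ (state ε y) ε y m s (state-agree ε ly)
    state-agree {x⁺@(x ▷[ k , v ])} {y⁺@(y ▷[ m , u ])} (lx ▷ r) (ly ▷ s) =
      if-intro (λ w → AgreeLast w x⁺ y⁺) (k ≤ᵇ m)
        (step-agree₂ (state x⁺ y) x⁺ y m s (state-agree (lx ▷ r) ly))
        (step-agree₁ (state x y⁺) x y⁺ k r (state-agree lx (ly ▷ s)))

    module Row {y : Word} (ly : Legal #2 y) = Line #1 (λ x → state x y) (height y) (state-▷₁ y) (λ lx → proj₁ (state-agree lx ly))

    module Column {x : Word} (lx : Legal #1 x) = Line #2 (state x) (height x) (state-▷₂ x) (λ ly → proj₂ (state-agree lx ly))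

    𝔉 : NFrame 2 ℓ
    𝔉 = 𝒩ᵈ (words #1) ⊗ 𝒩ᵈ (words #2)

    -- The truth lemma

    valuation : Valuation 𝔉
    valuation p (x , y) = Lift ℓ (state x y ∋ var p)

    truth⁺ : ∀ A {x y} → Legal #1 x → Legal #2 y → state x y ∋ A → Truth 𝔉 valuation (x , y) A
    truth⁻ : ∀ A {x y} → Legal #1 x → Legal #2 y → Truth 𝔉 valuation (x , y) A → state x y ∋ A

    truth⁺ (var p) lx ly A∈w = lift (lift A∈w)
    truth⁺ ⊥ {x} {y} lx ly A∈w = contradiction A∈w (∋-⊥ (state x y))
    truth⁺ (A ⇒ B) {x} {y} lx ly A∈w t =
      truth⁺ B lx ly (∋-mp (state x y) A∈w (truth⁻ A lx ly t))
    truth⁺ (□ #1 A) {x} {y} lx ly A∈w =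
      -- From the bound `height y` on, letters appended to `x` are read after all of `y`.
      _ , (_ , τᵈ-cone #1 x (height y) , id) , λ { (x′ , _) (x≺x′ , refl) →
        truth⁺ A (≺-legal #1 lx x≺x′) ly (∋□⇒∋ (Row.h-forth ly lx x≺x′) A∈w) }
    truth⁺ (□ #2 A) {x} {y} lx ly A∈w =
      _ , (_ , τᵈ-cone #2 y (height x) , id) , λ { (_ , y′) (refl , y≺y′) →
        truth⁺ A lx (≺-legal #2 ly y≺y′) (∋□⇒∋ (Column.h-forth lx ly y≺y′) A∈w) }

    truth⁻ (var p) lx ly t = lower (lower t)
    truth⁻ (A ⇒ B) {x} {y} lx ly t with mem (state x y) A in eq
    ... | true  = trans (mem-⇒ (state x y) A B)
                    (trans (cong (λ a → not a ∨ mem (state x y) B) eq)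
                      (truth⁻ B lx ly (t (truth⁺ A lx ly eq))))
    ... | false = trans (mem-⇒ (state x y) A B) (cong (λ a → not a ∨ mem (state x y) B) eq)
    truth⁻ (□ #1 A) {x} {y} lx ly (P , (V , V∈τ , V⊆P) , t) with em {state x y ∋ □ #1 A}
    ... | yes □A∈w = □A∈w
    ... | no  □A∉w with □-witness #1 (state x y) □A∉w | τᵈ⇒cone #1 V∈τ
    -- Every cone at `x` contains a word whose state is the witness `v`, so `A` would be true there.
    ...   | v , wRv , A∉v | k , cone⊆V with Row.h-back ly lx wRv k
    ...     | x′ , x≺x′ , refl = contradiction
      (truth⁻ A (≺-legal #1 lx x≺x′) ly (t (x′ , y) (V⊆P (cone⊆V x≺x′ , refl)))) A∉v
    truth⁻ (□ #2 A) {x} {y} lx ly (P , (V , V∈τ , V⊆P) , t) with em {state x y ∋ □ #2 A}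
    ... | yes □A∈w = □A∈w
    ... | no  □A∉w with □-witness #2 (state x y) □A∉w | τᵈ⇒cone #2 V∈τ
    ...   | v , wRv , A∉v | k , cone⊆V with Column.h-back lx ly wRv k
    ...     | y′ , y≺y′ , refl = contradiction
      (truth⁻ A lx (≺-legal #2 ly y≺y′) (t (x , y′) (V⊆P (refl , cone⊆V y≺y′)))) A∉v

completeness : ExcludedMiddle (suc ℓ) → d-Logic {ℓ} T₁ T₁ ⊆ ⟨ K4 , K4 ⟩
completeness {ℓ} em {A} valid = decidable-stable em₀ λ A∉L →
  let
    (w₀ , Γ⊆w₀) = lindenbaum {｛ A ⇒ ⊥ ｝} λ d →
      A∉L (∅⊢ (mp (thm (¬¬-elim A)) (deduction (weaken inj₂ d))))
    -- The two empty words are legal and their state is `w₀`, which already contains the negation of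
    -- `A`.
    A∈w₀ = truth⁻ w₀ A ε ε
      (valid (words w₀ #1) (words w₀ #2) (words-T₁ w₀ #1) (words-T₁ w₀ #2)
        (valuation w₀) (ε , ε))
  in ∋-⊥ w₀ (∋-mp w₀ (Γ⊆w₀ refl) A∈w₀)
  where
  em₀ : ExcludedMiddle 0ℓ
  em₀ = map′ lower lift (em {Lift (suc ℓ) _})

  open Countermodel ℓ em₀

theorem9p2 : ∀ {ℓ : Level} → ExcludedMiddle (suc ℓ) → d-Logic {ℓ} T₁ T₁ ≐ ⟨ K4 , K4 ⟩
theorem9p2 em = completeness em , soundness em
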